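{- Algorithm 1 (described in the context) is a 3-approximation algorithm for min-sum 2-MST: for every instance, the solution $\{T_b,T_r\}$ it returns (for any resolution of its arbitrary choices) satisfies $c(T_b)+c(T_r)\le 3\cdot\mathrm{OPT}$, where $\mathrm{OPT}$ is the minimum of $c(R)+c(B)$ over all feasible solutions.
   Context: An instance of 2-MST consists of $2n$ nodes $V$ (with $n$ even) partitioned into $n$ pairs $\{p_i,q_i\}$, together with metric edge weights $c$ on the complete graph on $V$ (nonnegative, triangle inequality). A feasible solution colors, for each $i$, one of $p_i,q_i$ red and the other blue, and consists of a spanning tree $R$ on the red nodes and a spanning tree $B$ on the blue nodes. The min-sum objective is to minimize $c(R)+c(B)$, where $c(F)$ is the total weight of an edge set $F$. Algorithm 1: (1) compute a minimum spanning tree $T$ on all $2n$ nodes; (2) delete a maximum-weight edge $e_\times$ of $T$, obtaining two trees $T_L,T_R$ on node sets $V_L,V_R$; (3) for each pair with $p_i\in V_L$ and $q_i\in V_R$ (up to renaming within the pair), color the node in $V_L$ blue and the node in $V_R$ red; (4) for every other pair, assign its two nodes arbitrary distinct colors; (5) for each color, compute a minimum spanning tree $T_b$ (resp. $T_r$) of the nodes of that color; return $\{T_b,T_r\}$.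
   Formalization: The metric edge weights c are taken to be rational numbers instead of real numbers. -}

module Defs where

open import Data.Nat using (ℕ)
open import Data.Fin using (Fin)
open import Data.Bool using (Bool; true; false; not; if_then_else_)
open import Data.Product using (_×_; _,_; proj₁; proj₂)
open import Data.Sum using (_⊎_)
open import Data.List using (List; foldr)
open import Data.List.Membership.Propositional using (_∈_)
open import Data.List.Relation.Unary.Any using (_─_)
open import Data.Integer using (+_)
open import Data.Rational using (ℚ; 0ℚ; _+_; _≤_; _/_)
open import Relation.Binary.PropositionalEquality using (_≡_)
open import Relation.Nullary using (¬_)
open import Data.Unit using (⊤)

-- Nodes of an instance with n pairs: (i , false) is p_i, (i , true) is q_i.
Node : ℕ → Set
Node n = Fin n × Bool

-- An edge of the complete graph, given by its two endpoints (unordered use).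
Edge : ℕ → Set
Edge n = Node n × Node n

record IsMetric {n : ℕ} (c : Node n → Node n → ℚ) : Set where
  field
    nonneg   : ∀ u v → 0ℚ ≤ c u v
    symmetric : ∀ u v → c u v ≡ c v u
    triangle : ∀ u v w → c u w ≤ c u v + c v w

weight : {n : ℕ} → (Node n → Node n → ℚ) → Edge n → ℚ
weight c (u , v) = c u v

cost : {n : ℕ} → (Node n → Node n → ℚ) → List (Edge n) → ℚ
cost c F = foldr (λ e acc → weight c e + acc) 0ℚ F

data Conn {n : ℕ} (F : List (Edge n)) : Node n → Node n → Set where
  here : ∀ {u} → Conn F u u
  step : ∀ {u w v} → ((u , w) ∈ F ⊎ (w , u) ∈ F) → Conn F w v → Conn F u v

-- F is a spanning tree of the node set S:
--  * every edge has both endpoints in S,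
--  * (connected) any two nodes of S are joined by a path in F,
--  * (acyclic) no edge lies on a cycle: removing any edge (occurrence) of F
--    disconnects its endpoints (this also excludes loops and parallel edges).
record IsSpanningTree {n : ℕ} (S : Node n → Set) (F : List (Edge n)) : Set where
  field
    inside    : ∀ {e} → e ∈ F → S (proj₁ e) × S (proj₂ e)
    connected : ∀ u v → S u → S v → Conn F u v
    acyclic   : ∀ {e} (p : e ∈ F) → ¬ Conn (F ─ p) (proj₁ e) (proj₂ e)

record IsMST {n : ℕ} (c : Node n → Node n → ℚ) (S : Node n → Set) (F : List (Edge n)) : Set where
  field
    tree    : IsSpanningTree S F
    minimal : ∀ F' → IsSpanningTree S F' → cost c F ≤ cost c F'

red blue : Bool
red  = true
blue = false

-- A coloring assigns to each pair i the color of q_i; p_i gets the other color.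
colorOf : {n : ℕ} → (Fin n → Bool) → Node n → Bool
colorOf col (i , b) = if b then col i else not (col i)

ColorClass : {n : ℕ} → (Fin n → Bool) → Bool → Node n → Set
ColorClass col k x = colorOf col x ≡ k

AllNodes : {n : ℕ} → Node n → Set
AllNodes _ = ⊤

-- Step (3) of Algorithm 1: T is the MST, ex ∈ T (occurrence p) the deleted edge;
-- V_L = nodes connected to the first endpoint of ex in T ∖ {ex},
-- V_R = nodes connected to the second endpoint of ex in T ∖ {ex}.
-- Every pair with one node in V_L and the other in V_R has its V_L-node blue
-- (hence its V_R-node red). Other pairs are colored arbitrarily (step 4).
SplitColoring : {n : ℕ} (T : List (Edge n)) {ex : Edge n} → ex ∈ T → (Fin n → Bool) → Set
SplitColoring T {ex} p col =
  ∀ i b → Conn (T ─ p) (proj₁ ex) (i , b) → Conn (T ─ p) (proj₂ ex) (i , not b) →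
  colorOf col (i , b) ≡ blue

three : ℚ
three = + 3 / 1

{-# OPTIONS --safe #-}
-- Write e for the deleted edge. If the split separates every pair, both returned trees cost
-- together at most c(T_L) + c(T_R) ≤ OPT. In general a 2-coloured tree T has spanning trees of its two
-- colour classes of total cost ≤ 3 c(T): at a root v, the nodes of v's colour hang from v, the others
-- are visited by a closed tour from v; grafting a subtree along an edge uses that edge once
-- for the colour of v and twice for the other. Edges on a path leaving the root need be used only twice,
-- once per colour, because the tour may start at the far end of that path.
-- If a side, say T_L, contains a pair, it has an edge m_L that is bicoloured in the optimum, so
-- OPT ≥ c(T) − c(m_L). If both sides do, the path through m_L, e, m_R is used only twice and the cost
-- is at most 3 c(T) − c(e) − c(m_L) − c(m_R); if only T_R does, T_L is monochromatic and
-- the cost is at most c(T_L) + c(e) + 3 c(T_R) − c(m_R). As e is heaviest, both are ≤ 3 OPT.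
module Submission where

open import Defs
open import Data.Nat using (ℕ; zero; suc)
open import Data.Nat.Divisibility using (_∣_)
import Data.Nat.Properties as ℕ
open import Data.Fin using (Fin)
import Data.Fin.Properties as Fin
open import Data.Bool using (Bool; true; false; not)
import Data.Bool.Properties as Bool
open import Data.Product using (_×_; _,_; proj₁; proj₂; ∃; ∃₂)
open import Data.Product.Properties using (≡-dec)
open import Data.Sum using (_⊎_; inj₁; inj₂; [_,_]′; swap)
import Data.Sum as Sum
open import Data.Empty using (⊥)
open import Data.Unit using (⊤; tt)
open import Data.List using (List; []; _∷_; _++_; length)
open import Data.List.Membership.Propositional using (_∈_)
open import Data.List.Membership.Propositional.Properties using (∈-++⁺ˡ; ∈-++⁺ʳ; ∈-++⁻)
open import Data.List.Relation.Unary.Any as Any using (Any; here; there; _─_; any?)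
open import Data.List.Relation.Unary.Any.Properties using (lookup-result)
open import Data.Rational using (ℚ; 0ℚ; -_; _+_; _*_; _≤_)
import Data.Rational.Properties as ℚ
open import Data.Rational.Solver using (module +-*-Solver)
open import Function using (_∘_; id)
open import Relation.Binary.PropositionalEquality
  using (_≡_; _≢_; refl; sym; trans; cong; cong₂; subst; subst₂)
open import Relation.Nullary using (¬_; Dec; yes; no; contradiction)
open import Relation.Nullary.Decidable using (map′; _×-dec_; _⊎-dec_)

open +-*-Solver using (solve; _:+_; _:=_; con; _:*_)

-- Rational inequalities

-- Derives a ≤ b from a sum of hypotheses l ≤ r, leaving a semiring identity to the solver.
transfer-≤ : ∀ {l r a b} → l ≤ r → a + r ≡ b + l → a ≤ b
transfer-≤ {l} {r} {a} {b} l≤r eq = begin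
  a               ≡⟨ cancel a r ⟨
  a + r + - r     ≡⟨ cong (_+ - r) eq ⟩
  b + l + - r     ≤⟨ ℚ.+-monoˡ-≤ (- r) (ℚ.+-monoʳ-≤ b l≤r) ⟩
  b + r + - r     ≡⟨ cancel b r ⟩
  b               ∎
  where
  open ℚ.≤-Reasoning
  cancel : ∀ x y → x + y + - y ≡ x
  cancel x y = trans (ℚ.+-assoc x y (- y)) (trans (cong (x +_) (ℚ.+-inverseʳ y)) (ℚ.+-identityʳ x))

triple : ℚ → ℚ
triple x = x + (x + x)

triple-mono : ∀ {x y} → x ≤ y → triple x ≤ triple y
triple-mono x≤y = ℚ.+-mono-≤ x≤y (ℚ.+-mono-≤ x≤y x≤y)

three*≡triple : ∀ x → three * x ≡ triple x
three*≡triple = solve 1 (λ x → con three :* x := x :+ (x :+ x)) refl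

-- Lists with one occurrence deleted

module _ {a p} {A : Set a} {P : A → Set p} where

  ∈-─⁻ : ∀ {xs x} (q : Any P xs) → x ∈ (xs ─ q) → x ∈ xs
  ∈-─⁻ (here _)  i         = there i
  ∈-─⁻ (there _) (here eq) = here eq
  ∈-─⁻ (there q) (there i) = there (∈-─⁻ q i)

  ∈-─⁺ : ∀ {xs x} (q : Any P xs) → x ∈ xs → x ≡ Any.lookup q ⊎ x ∈ (xs ─ q)
  ∈-─⁺ (here _)  (here eq) = inj₁ eq
  ∈-─⁺ (here _)  (there i) = inj₂ i
  ∈-─⁺ (there _) (here eq) = inj₂ (here eq)
  ∈-─⁺ (there q) (there i) = Sum.map₂ there (∈-─⁺ q i)

  lookup-∈ : ∀ {xs} (q : Any P xs) → Any.lookup q ∈ xs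
  lookup-∈ (here _)  = here refl
  lookup-∈ (there q) = there (lookup-∈ q)

  length-─ : ∀ {xs} (q : Any P xs) → length xs ≡ suc (length (xs ─ q))
  length-─ (here _)  = refl
  length-─ (there q) = cong suc (length-─ q)

-- Connectivity and acyclicity of edge lists

module _ {n : ℕ} where

  _≟ₙ_ : (x y : Node n) → Dec (x ≡ y)
  _≟ₙ_ = ≡-dec Fin._≟_ Bool._≟_

  Joins : List (Edge n) → Node n → Node n → Set
  Joins F u w = (u , w) ∈ F ⊎ (w , u) ∈ F

  Joins-⊆ : ∀ {F G u w} → (∀ {e} → e ∈ F → e ∈ G) → Joins F u w → Joins G u w
  Joins-⊆ F⊆G = Sum.map F⊆G F⊆G

  Conn-trans : ∀ {F : List (Edge n)} {u v w} → Conn F u v → Conn F v w → Conn F u w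
  Conn-trans here       q = q
  Conn-trans (step j p) q = step j (Conn-trans p q)

  Conn-edge : ∀ {F : List (Edge n)} {u v} → Joins F u v → Conn F u v
  Conn-edge j = step j here

  Conn-sym : ∀ {F : List (Edge n)} {u v} → Conn F u v → Conn F v u
  Conn-sym here       = here
  Conn-sym (step j p) = Conn-trans (Conn-sym p) (Conn-edge (swap j))

  Conn-mono : ∀ {F G : List (Edge n)} {u v} → (∀ {e} → e ∈ F → e ∈ G) → Conn F u v → Conn G u v
  Conn-mono F⊆G here       = here
  Conn-mono F⊆G (step j p) = step (Joins-⊆ F⊆G j) (Conn-mono F⊆G p)

  Conn-closed : ∀ {F u v} (P : Node n → Set) → (∀ {x y} → Joins F x y → P x → P y) →
                Conn F u v → P u → P v
  Conn-closed P closed here       = id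
  Conn-closed P closed (step j p) = Conn-closed P closed p ∘ closed j

  -- Connectivity in e ∷ F expressed in F, which makes it decidable by recursion on the edge list.
  Through : List (Edge n) → Edge n → Node n → Node n → Set
  Through F (a , b) u v = Conn F u v ⊎ (Conn F u a × Conn F b v ⊎ Conn F u b × Conn F a v)

  Conn-∷⁺ : ∀ {F e u v} → Through F e u v → Conn (e ∷ F) u v
  Conn-∷⁺ (inj₁ p)              = Conn-mono there p
  Conn-∷⁺ (inj₂ (inj₁ (p , q))) =
    Conn-trans (Conn-mono there p) (step (inj₁ (here refl)) (Conn-mono there q))
  Conn-∷⁺ (inj₂ (inj₂ (p , q))) =
    Conn-trans (Conn-mono there p) (step (inj₂ (here refl)) (Conn-mono there q))

  Through-step : ∀ {F e u w v} → Joins F u w → Through F e w v → Through F e u v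
  Through-step j = Sum.map (step j) (Sum.map (λ (p , q) → step j p , q) (λ (p , q) → step j p , q))

  -- When a step along the new edge precedes a walk that crosses it already, everything up to the
  -- last crossing is dropped, so at most one crossing survives.
  Conn-∷⁻ : ∀ {F e u v} → Conn (e ∷ F) u v → Through F e u v
  Conn-∷⁻ here = inj₁ here
  Conn-∷⁻ (step j p) with Conn-∷⁻ p
  Conn-∷⁻ (step (inj₁ (here refl)) _) | inj₁ q              = inj₂ (inj₁ (here , q))
  Conn-∷⁻ (step (inj₁ (here refl)) _) | inj₂ (inj₁ (_ , q)) = inj₂ (inj₁ (here , q))
  Conn-∷⁻ (step (inj₁ (here refl)) _) | inj₂ (inj₂ (_ , q)) = inj₁ q
  Conn-∷⁻ (step (inj₂ (here refl)) _) | inj₁ q              = inj₂ (inj₂ (here , q))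
  Conn-∷⁻ (step (inj₂ (here refl)) _) | inj₂ (inj₁ (_ , q)) = inj₁ q
  Conn-∷⁻ (step (inj₂ (here refl)) _) | inj₂ (inj₂ (_ , q)) = inj₂ (inj₂ (here , q))
  Conn-∷⁻ (step (inj₁ (there i)) _) | t                     = Through-step (inj₁ i) t
  Conn-∷⁻ (step (inj₂ (there i)) _) | t                     = Through-step (inj₂ i) t

  conn? : ∀ F (u v : Node n) → Dec (Conn F u v)
  conn? [] u v = map′
    (λ { refl → here }) (λ { here → refl ; (step (inj₁ ()) _) ; (step (inj₂ ()) _) }) (u ≟ₙ v)
  conn? ((a , b) ∷ F) u v = map′ Conn-∷⁺ Conn-∷⁻
    (conn? F u v ⊎-dec ((conn? F u a ×-dec conn? F b v) ⊎-dec (conn? F u b ×-dec conn? F a v)))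

  Acyclic : List (Edge n) → Set
  Acyclic F = ∀ {e} (p : e ∈ F) → ¬ Conn (F ─ p) (proj₁ e) (proj₂ e)

  -- A cycle through an old edge either avoids the new one, or its remaining pieces together with
  -- the old edge join `a` to `b` in `F`.
  Acyclic-∷ : ∀ {F a b} → Acyclic F → ¬ Conn F a b → Acyclic ((a , b) ∷ F)
  Acyclic-∷ acyclic a≁b (here refl) p = a≁b p
  Acyclic-∷ {F} acyclic a≁b {x , y} (there q) p with Conn-∷⁻ p
  ... | inj₁ r = acyclic q r
  ... | inj₂ (inj₁ (r , s)) = a≁b
    (Conn-trans (Conn-sym (widen r)) (step (inj₁ q) (Conn-sym (widen s))))
    where
    widen : ∀ {u v} → Conn (F ─ q) u v → Conn F u v
    widen = Conn-mono (∈-─⁻ q)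
  ... | inj₂ (inj₂ (r , s)) = a≁b (Conn-trans (widen s) (step (inj₂ q) (widen r)))
    where
    widen : ∀ {u v} → Conn (F ─ q) u v → Conn F u v
    widen = Conn-mono (∈-─⁻ q)

-- Rooted trees

-- graft t s hangs s below the root of t by an edge between the two roots.
data Tree (n : ℕ) : Set where
  leaf  : Node n → Tree n
  graft : Tree n → Tree n → Tree n

module _ {n : ℕ} where

  root : Tree n → Node n
  root (leaf v)    = v
  root (graft t _) = root t

  In : Tree n → Node n → Set
  In (leaf v)    x = x ≡ v
  In (graft t s) x = In t x ⊎ In s x

  in? : ∀ t x → Dec (In t x)
  in? (leaf v)    x = x ≟ₙ v
  in? (graft t s) x = in? t x ⊎-dec in? s x

  root-In : ∀ t → In t (root t)
  root-In (leaf v)    = refl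
  root-In (graft t s) = inj₁ (root-In t)

  AllEdges : (Node n → Node n → Set) → Tree n → Set
  AllEdges P (leaf _)    = ⊤
  AllEdges P (graft t s) = AllEdges P t × P (root t) (root s) × AllEdges P s

  AllEdges-map : ∀ {P Q : Node n → Node n → Set} → (∀ {x y} → P x y → Q x y) →
                 ∀ t → AllEdges P t → AllEdges Q t
  AllEdges-map f (leaf _)    _             = tt
  AllEdges-map f (graft t s) (ps , p , qs) = AllEdges-map f t ps , f p , AllEdges-map f s qs

  In⇒Conn : ∀ {G} t {x} → AllEdges (Joins G) t → In t x → Conn G (root t) x
  In⇒Conn (leaf _)    _            refl     = here
  In⇒Conn (graft t s) (ps , _)     (inj₁ i) = In⇒Conn t ps i
  In⇒Conn (graft t s) (_ , j , qs) (inj₂ i) = step j (In⇒Conn s qs i)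

  -- The membership proof serves as the path to the place of insertion.
  attach : ∀ t {a} → In t a → Node n → Tree n
  attach (leaf v)    _        b = graft (leaf v) (leaf b)
  attach (graft t s) (inj₁ i) b = graft (attach t i b) s
  attach (graft t s) (inj₂ i) b = graft t (attach s i b)

  root-attach : ∀ t {a} (i : In t a) b → root (attach t i b) ≡ root t
  root-attach (leaf v)    _        b = refl
  root-attach (graft t s) (inj₁ i) b = root-attach t i b
  root-attach (graft t s) (inj₂ i) b = refl

  attach-⊇ : ∀ t {a x} (i : In t a) b → In t x → In (attach t i b) x
  attach-⊇ (leaf v)    _        b h        = inj₁ h
  attach-⊇ (graft t s) (inj₁ i) b (inj₁ h) = inj₁ (attach-⊇ t i b h)
  attach-⊇ (graft t s) (inj₁ i) b (inj₂ h) = inj₂ h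
  attach-⊇ (graft t s) (inj₂ i) b (inj₁ h) = inj₁ h
  attach-⊇ (graft t s) (inj₂ i) b (inj₂ h) = inj₂ (attach-⊇ s i b h)

  attach-new : ∀ t {a} (i : In t a) b → In (attach t i b) b
  attach-new (leaf v)    _        b = inj₂ refl
  attach-new (graft t s) (inj₁ i) b = inj₁ (attach-new t i b)
  attach-new (graft t s) (inj₂ i) b = inj₂ (attach-new s i b)

  AllEdges-attach : ∀ {P : Node n → Node n → Set} t {a} (i : In t a) b →
                    P a b → AllEdges P t → AllEdges P (attach t i b)
  AllEdges-attach (leaf v) refl b p _ = tt , p , tt
  AllEdges-attach {P} (graft t s) (inj₁ i) b p (ps , q , qs) =
    AllEdges-attach t i b p ps , subst (λ r → P r (root s)) (sym (root-attach t i b)) q , qs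
  AllEdges-attach {P} (graft t s) (inj₂ i) b p (ps , q , qs) =
    ps , subst (P (root t)) (sym (root-attach s i b)) q , AllEdges-attach s i b p qs

-- Costs and comparison with minimum spanning trees

module Metric {n : ℕ} {c : Node n → Node n → ℚ} (metric : IsMetric c) where

  open IsMetric metric

  0≤cost : ∀ F → 0ℚ ≤ cost c F
  0≤cost []            = ℚ.≤-refl
  0≤cost ((u , v) ∷ F) = ℚ.+-mono-≤ (nonneg u v) (0≤cost F)

  cost-++ : ∀ F G → cost c (F ++ G) ≡ cost c F + cost c G
  cost-++ []      G = sym (ℚ.+-identityˡ (cost c G))
  cost-++ (e ∷ F) G = trans (cong (weight c e +_) (cost-++ F G))
                            (sym (ℚ.+-assoc (weight c e) (cost c F) (cost c G)))

  cost-─ : ∀ {p} {P : Edge n → Set p} {F} (q : Any P F) →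
           cost c F ≡ weight c (Any.lookup q) + cost c (F ─ q)
  cost-─ (here _)              = refl
  cost-─ {F = e ∷ F} (there q) = trans (cong (weight c e +_) (cost-─ q))
    (solve 3 (λ x y z → x :+ (y :+ z) := y :+ (x :+ z)) refl
      (weight c e) (weight c (Any.lookup q)) (cost c (F ─ q)))

  record SpanningForest (F : List (Edge n)) : Set where
    field
      forest  : List (Edge n)
      subset  : ∀ {e} → e ∈ forest → e ∈ F
      cheaper : cost c forest ≤ cost c F
      spans   : ∀ {u v} → Conn F u v → Conn forest u v
      acyclic : Acyclic forest

  -- Kruskal's rule applied from the end of the list, without sorting: an edge whose ends are
  -- already connected is dropped, which by nonnegativity does not raise the cost; any other edge
  -- closes no cycle.
  kruskal : ∀ F → SpanningForest F
  kruskal [] = record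
    { forest = [] ; subset = id ; cheaper = ℚ.≤-refl ; spans = id ; acyclic = λ () }
  kruskal ((a , b) ∷ F) with kruskal F
  ... | rec with conn? (SpanningForest.forest rec) a b
  ...   | yes a~b = record
    { forest  = forest
    ; subset  = there ∘ subset
    ; cheaper = ℚ.≤-trans cheaper
        (transfer-≤ (nonneg a b)
          (solve 2 (λ x y → x :+ y := (y :+ x) :+ con 0ℚ) refl (cost c F) (c a b)))
    ; spans   = [ spans
                , [ (λ (p , q) → Conn-trans (spans p) (Conn-trans a~b (spans q)))
                  , (λ (p , q) → Conn-trans (spans p) (Conn-trans (Conn-sym a~b) (spans q)))
                  ]′ ]′ ∘ Conn-∷⁻
    ; acyclic = acyclic
    }
    where open SpanningForest rec
  ...   | no a≁b = record
    { forest  = (a , b) ∷ forest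
    ; subset  = λ { (here eq) → here eq ; (there i) → there (subset i) }
    ; cheaper = ℚ.+-monoʳ-≤ (c a b) cheaper
    ; spans   = Conn-∷⁺ ∘ Sum.map spans (Sum.map (λ (p , q) → spans p , spans q)
                                                 (λ (p , q) → spans p , spans q)) ∘ Conn-∷⁻
    ; acyclic = Acyclic-∷ acyclic a≁b
    }
    where open SpanningForest rec

  -- Thinning `F` by `kruskal` gives a spanning tree to compete with, so later competitors need only
  -- be connected.
  MST-≤ : ∀ {S M F} → IsMST c S M →
          (∀ {e} → e ∈ F → S (proj₁ e) × S (proj₂ e)) →
          (∀ u v → S u → S v → Conn F u v) →
          cost c M ≤ cost c F
  MST-≤ {F = F} mst inside connected = ℚ.≤-trans (IsMST.minimal mst forest tree) cheaper
    where
    open SpanningForest (kruskal F)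
    tree = record
      { inside    = inside ∘ subset
      ; connected = λ u v Su Sv → spans (connected u v Su Sv)
      ; acyclic   = acyclic
      }

  -- Rooted trees grown from an edge list

  treeCost : Tree n → ℚ
  treeCost (leaf _)    = 0ℚ
  treeCost (graft t s) = treeCost t + (c (root t) (root s) + treeCost s)

  treeCost-attach : ∀ t {a} (i : In t a) b → treeCost (attach t i b) ≡ treeCost t + c a b
  treeCost-attach (leaf v) refl b = cong (0ℚ +_) (ℚ.+-identityʳ (c v b))
  treeCost-attach (graft t s) {a} (inj₁ i) b
    rewrite root-attach t i b | treeCost-attach t i b =
    solve 4 (λ x y z w → (x :+ y) :+ (z :+ w) := (x :+ (z :+ w)) :+ y) refl
      (treeCost t) (c a b) (c (root t) (root s)) (treeCost s)
  treeCost-attach (graft t s) {a} (inj₂ i) b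
    rewrite root-attach s i b | treeCost-attach s i b =
    solve 4 (λ x y z w → x :+ (z :+ (w :+ y)) := (x :+ (z :+ w)) :+ y) refl
      (treeCost t) (c a b) (c (root t) (root s)) (treeCost s)

  -- The outcome of enlarging t by edges of F, all taken from G, until no remaining edge touches it.
  record Growth (G F : List (Edge n)) (t : Tree n) : Set where
    field
      tree      : Tree n
      rest      : List (Edge n)
      same-root : root tree ≡ root t
      total     : treeCost tree + cost c rest ≤ treeCost t + cost c F
      extends   : ∀ {x} → In t x → In tree x
      rest⊆     : ∀ {e} → e ∈ rest → e ∈ F
      used      : ∀ {e} → e ∈ F → e ∈ rest ⊎ In tree (proj₁ e) × In tree (proj₂ e)
      untouched : ∀ {e} → e ∈ rest → ¬ (In tree (proj₁ e) ⊎ In tree (proj₂ e))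
      edges     : AllEdges (Joins G) tree

  Touches : Tree n → Edge n → Set
  Touches t e = In t (proj₁ e) ⊎ In t (proj₂ e)

  -- Edges are listed in either orientation; the equation fixes the reading in which the end already
  -- in the tree is `a`.
  grow-at : ∀ {G F t} (q : Any (Touches t) F) {a b} (i : In t a) →
            (a , b) ≡ Any.lookup q ⊎ (b , a) ≡ Any.lookup q →
            Growth G (F ─ q) (attach t i b) → Growth G F t
  grow-at {F = F} {t} q {a} {b} i eq g = record
    { tree      = tree
    ; rest      = rest
    ; same-root = trans same-root (root-attach t i b)
    ; total     = ℚ.≤-trans total (ℚ.≤-reflexive total-eq)
    ; extends   = extends ∘ attach-⊇ t i b
    ; rest⊆     = ∈-─⁻ q ∘ rest⊆
    ; used      = λ e∈F → [ inj₂ ∘ ends eq , used ]′ (∈-─⁺ q e∈F)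
    ; untouched = untouched
    ; edges     = edges
    }
    where
    open Growth g
    ends : ∀ {x e} → (a , b) ≡ x ⊎ (b , a) ≡ x → e ≡ x → In tree (proj₁ e) × In tree (proj₂ e)
    ends (inj₁ refl) refl = extends (attach-⊇ t i b i) , extends (attach-new t i b)
    ends (inj₂ refl) refl = extends (attach-new t i b) , extends (attach-⊇ t i b i)
    c-lookup : ∀ {x} → (a , b) ≡ x ⊎ (b , a) ≡ x → weight c x ≡ c a b
    c-lookup (inj₁ refl) = refl
    c-lookup (inj₂ refl) = symmetric b a
    total-eq : treeCost (attach t i b) + cost c (F ─ q) ≡ treeCost t + cost c F
    total-eq rewrite treeCost-attach t i b | cost-─ q | c-lookup eq =
      ℚ.+-assoc (treeCost t) (c a b) (cost c (F ─ q))

  -- The recursion runs on the length `k`, as `F ─ q` is not a subterm of `F`. A tree may repeat a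
  -- node: only its cost and the nodes it covers enter the estimates.
  grow : ∀ {G} k F → length F ≡ k → (∀ {e} → e ∈ F → e ∈ G) →
         ∀ t → AllEdges (Joins G) t → Growth G F t
  grow k F len F⊆G t es with any? (λ e → in? t (proj₁ e) ⊎-dec in? t (proj₂ e)) F
  grow k F len F⊆G t es | no untouched = record
    { tree = t ; rest = F ; same-root = refl ; total = ℚ.≤-refl ; extends = id ; rest⊆ = id
    ; used = inj₁
    ; untouched = λ e∈F h → untouched (Any.map (λ { refl → h }) e∈F)
    ; edges = es
    }
  grow zero [] len F⊆G t es | yes ()
  grow (suc k) F len F⊆G t es | yes q with lookup-result q | F⊆G (lookup-∈ q)
  ... | inj₁ i | e∈G = grow-at q i (inj₁ refl)
    (grow k (F ─ q) (ℕ.suc-injective (trans (sym (length-─ q)) len)) (F⊆G ∘ ∈-─⁻ q)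
      _ (AllEdges-attach t i _ (inj₁ e∈G) es))
  ... | inj₂ i | e∈G = grow-at q i (inj₂ refl)
    (grow k (F ─ q) (ℕ.suc-injective (trans (sym (length-─ q)) len)) (F⊆G ∘ ∈-─⁻ q)
      _ (AllEdges-attach t i _ (inj₂ e∈G) es))

  -- Tours through one colour class

  module Coloring (zero-diagonal : ∀ v → c v v ≡ 0ℚ) (f : Node n → Bool) where

    infixr 5 _∪_
    _∪_ : (Node n → Set) → (Node n → Set) → Node n → Set
    (V ∪ W) x = V x ⊎ W x

    Mono : Bool → List (Edge n) → Set
    Mono k F = ∀ {e} → e ∈ F → f (proj₁ e) ≡ k × f (proj₂ e) ≡ k

    Mono-link : ∀ {k F G u v} → Mono k F → f u ≡ k → f v ≡ k → Mono k G → Mono k (F ++ (u , v) ∷ G)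
    Mono-link {F = F} mF fu fv mG i with ∈-++⁻ F i
    ... | inj₁ i∈F          = mF i∈F
    ... | inj₂ (here refl)  = fu , fv
    ... | inj₂ (there i∈G)  = mG i∈G

    linkˡ : ∀ {F G : List (Edge n)} {u v x y} → Conn F x y → Conn (F ++ (u , v) ∷ G) x y
    linkˡ = Conn-mono ∈-++⁺ˡ

    linkʳ : ∀ F {G : List (Edge n)} {u v x} → Conn G v x → Conn (F ++ (u , v) ∷ G) u x
    linkʳ F p = step (inj₁ (∈-++⁺ʳ F (here refl))) (Conn-mono (∈-++⁺ʳ F ∘ there) p)

    -- A tour from p to q through the k-coloured nodes of V, short-cut to a connected edge list F on nodes
    -- of colour k with entry node s and exit node t; the legs p–s and t–q are charged to d but are not in F.
    data Tour (k : Bool) (V : Node n → Set) (p q : Node n) (d : ℚ) : Set where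
      skip  : (∀ {x} → V x → f x ≢ k) → c p q ≤ d → Tour k V p q d
      visit : ∀ F s t → Mono k F → f s ≡ k → f t ≡ k →
              (∀ {x} → V x → f x ≡ k → Conn F s x) → Conn F s t →
              c p s + (cost c F + c t q) ≤ d → Tour k V p q d

    -- For the colour of the root the edge list can contain the root itself, so no legs are charged.
    -- This is why a grafted subtree costs this colour only one use of the connecting edge.
    record Anchored (k : Bool) (V : Node n → Set) (r : Node n) (d : ℚ) : Set where
      constructor anchored
      field
        links   : List (Edge n)
        mono    : Mono k links
        colored : f r ≡ k
        reaches : ∀ {x} → V x → f x ≡ k → Conn links r x
        bounded : cost c links ≤ d

    0≤Tour : ∀ {k V p q d} → Tour k V p q d → 0ℚ ≤ d
    0≤Tour {p = p} {q} (skip _ h) = ℚ.≤-trans (nonneg p q) h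
    0≤Tour {p = p} {q} (visit F s t _ _ _ _ _ h) =
      ℚ.≤-trans (ℚ.+-mono-≤ (nonneg p s) (ℚ.+-mono-≤ (0≤cost F) (nonneg t q))) h

    Tour-⊆ : ∀ {k V W p q d} → (∀ {x} → W x → f x ≡ k → V x) → Tour k V p q d → Tour k W p q d
    Tour-⊆ W⊆V (skip none h) = skip (λ Wx fx → none (W⊆V Wx fx) fx) h
    Tour-⊆ W⊆V (visit F s t m fs ft reach st h) =
      visit F s t m fs ft (λ Wx fx → reach (W⊆V Wx fx) fx) st h

    Tour-reverse : ∀ {k V p q d} → Tour k V p q d → Tour k V q p d
    Tour-reverse {p = p} {q} (skip none h) = skip none (subst (_≤ _) (symmetric p q) h)
    Tour-reverse {p = p} {q} (visit F s t m fs ft reach st h) =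
      visit F t s m ft fs (λ Vx fx → Conn-trans (Conn-sym st) (reach Vx fx)) (Conn-sym st)
        (subst (_≤ _) eq h)
      where
      eq : c p s + (cost c F + c t q) ≡ c q t + (cost c F + c s p)
      eq rewrite symmetric p s | symmetric t q =
        solve 3 (λ x y z → x :+ (y :+ z) := z :+ (y :+ x)) refl (c s p) (cost c F) (c q t)

    -- The exit leg of the first tour and the entry leg of the second meet at `q`; the triangle
    -- inequality merges them into one edge, or into one leg if a tour is empty.
    Tour-++ : ∀ {k V W p q r d e} → Tour k V p q d → Tour k W q r e → Tour k (V ∪ W) p r (d + e)
    Tour-++ {p = p} {q} {r} (skip none h) (skip none′ h′) =
      skip [ none , none′ ]′ (ℚ.≤-trans (triangle p q r) (ℚ.+-mono-≤ h h′))
    Tour-++ {p = p} {q} {r} {d} {e} (skip none h) (visit F s t m fs ft reach st h′) =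
      visit F s t m fs ft
        [ (λ Vx fx → contradiction fx (none Vx)) , reach ]′ st
        (transfer-≤ (ℚ.+-mono-≤ (triangle p q s) (ℚ.+-mono-≤ h h′))
          (solve 7 (λ ps pq qs F tr d e →
              (ps :+ (F :+ tr)) :+ ((pq :+ qs) :+ (d :+ e)) :=
              (d :+ e) :+ (ps :+ (pq :+ (qs :+ (F :+ tr))))) refl
            (c p s) (c p q) (c q s) (cost c F) (c t r) d e))
    Tour-++ {p = p} {q} {r} {d} {e} (visit F s t m fs ft reach st h) (skip none h′) =
      visit F s t m fs ft
        [ reach , (λ Wx fx → contradiction fx (none Wx)) ]′ st
        (transfer-≤ (ℚ.+-mono-≤ (triangle t q r) (ℚ.+-mono-≤ h h′))
          (solve 7 (λ ps tq qr F tr d e →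
              (ps :+ (F :+ tr)) :+ ((tq :+ qr) :+ (d :+ e)) :=
              (d :+ e) :+ (tr :+ ((ps :+ (F :+ tq)) :+ qr))) refl
            (c p s) (c t q) (c q r) (cost c F) (c t r) d e))
    Tour-++ {p = p} {q} {r} {d} {e} (visit F s t m fs ft reach st h)
            (visit F′ s′ t′ m′ fs′ ft′ reach′ st′ h′) =
      visit (F ++ (t , s′) ∷ F′) s t′ (Mono-link m ft fs′ m′) fs ft′
        [ (λ Vx fx → linkˡ (reach Vx fx))
        , (λ Wx fx → Conn-trans (linkˡ st) (linkʳ F (reach′ Wx fx))) ]′
        (Conn-trans (linkˡ st) (linkʳ F st′))
        (transfer-≤ (ℚ.+-mono-≤ (triangle t q s′) (ℚ.+-mono-≤ h h′)) eq)
      where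
      eq : (c p s + (cost c (F ++ (t , s′) ∷ F′) + c t′ r)) + ((c t q + c q s′) + (d + e)) ≡
           (d + e) + (c t s′ + ((c p s + (cost c F + c t q)) + (c q s′ + (cost c F′ + c t′ r))))
      eq rewrite cost-++ F ((t , s′) ∷ F′) =
        solve 9 (λ ps F ts F′ tr tq qs d e →
            (ps :+ ((F :+ (ts :+ F′)) :+ tr)) :+ ((tq :+ qs) :+ (d :+ e)) :=
            (d :+ e) :+ (ts :+ ((ps :+ (F :+ tq)) :+ (qs :+ (F′ :+ tr))))) refl
          (c p s) (cost c F) (c t s′) (cost c F′) (c t′ r) (c t q) (c q s′) d e

    -- Concatenation with an empty tour of the empty set from `q` to `r`.
    Tour-move : ∀ {k V p q r d} → Tour k V p q d → Tour k V p r (d + c q r)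
    Tour-move {q = q} {r} tour =
      Tour-⊆ (λ Vx _ → inj₁ Vx) (Tour-++ {W = λ _ → ⊥} tour (skip (λ ()) ℚ.≤-refl))

    Anchored⇒Tour : ∀ {k V r d} → Anchored k V r d → Tour k V r r d
    Anchored⇒Tour {r = r} {d} (anchored F m fr reach h) =
      visit F r r m fr fr reach here (subst (_≤ d) eq h)
      where
      eq : cost c F ≡ c r r + (cost c F + c r r)
      eq rewrite zero-diagonal r = solve 1 (λ x → x := con 0ℚ :+ (x :+ con 0ℚ)) refl (cost c F)

    -- The tour hangs on by the edge from `r` to its entry node, paid for by `c r p` and the entry
    -- leg. Its exit leg is dropped, so it may end at any `q`.
    Anchored-++ : ∀ {k V W r p q a b} → Anchored k V r a → Tour k W p q b →
                  Anchored k (V ∪ W) r (a + (c r p + b))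
    Anchored-++ {r = r} {p} {a = a} {b} (anchored F m fr reach h) tour@(skip none _) =
      anchored F m fr [ reach , (λ Wx fx → contradiction fx (none Wx)) ]′
        (transfer-≤ (ℚ.+-mono-≤ h (ℚ.+-mono-≤ (nonneg r p) (0≤Tour tour)))
          (solve 4 (λ F a rp b → F :+ (a :+ (rp :+ b)) :=
                                 (a :+ (rp :+ b)) :+ (F :+ (con 0ℚ :+ con 0ℚ))) refl
            (cost c F) a (c r p) b))
    Anchored-++ {r = r} {p} {q} {a} {b} (anchored F m fr reach h) (visit F′ s t m′ fs ft reach′ st h′) =
      anchored (F ++ (r , s) ∷ F′) (Mono-link m fr fs m′) fr
        [ (λ Vx fx → linkˡ (reach Vx fx)) , (λ Wx fx → linkʳ F (reach′ Wx fx)) ]′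
        (transfer-≤ (ℚ.+-mono-≤ (ℚ.+-mono-≤ (triangle r p s) (nonneg t q)) (ℚ.+-mono-≤ h h′)) eq)
      where
      eq : cost c (F ++ (r , s) ∷ F′) + (((c r p + c p s) + c t q) + (a + b)) ≡
           (a + (c r p + b)) + ((c r s + 0ℚ) + (cost c F + (c p s + (cost c F′ + c t q))))
      eq rewrite cost-++ F ((r , s) ∷ F′) =
        solve 8 (λ F rs F′ rp ps tq a b →
            (F :+ (rs :+ F′)) :+ (((rp :+ ps) :+ tq) :+ (a :+ b)) :=
            (a :+ (rp :+ b)) :+ ((rs :+ con 0ℚ) :+ (F :+ (ps :+ (F′ :+ tq))))) refl
          (cost c F) (c r s) (cost c F′) (c r p) (c p s) (c t q) a b

    MST-≤-Tour : ∀ {k V p q d M} → IsMST c (λ x → f x ≡ k) M → (∀ x → V x) →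
                 Tour k V p q d → cost c M ≤ d
    MST-≤-Tour mst all tour@(skip none _) =
      -- No node has colour `k`, so the empty edge list is a competitor.
      ℚ.≤-trans (MST-≤ {F = []} mst (λ ()) (λ u _ fu _ → contradiction fu (none (all u)))) (0≤Tour tour)
    MST-≤-Tour {p = p} {q} mst all (visit F s t m fs ft reach st h) =
      ℚ.≤-trans (MST-≤ mst m (λ u v fu fv → Conn-trans (Conn-sym (reach (all u) fu)) (reach (all v) fv)))
        (transfer-≤ (ℚ.+-mono-≤ (ℚ.+-mono-≤ (nonneg p s) (nonneg t q)) h)
          (solve 4 (λ F ps tq d → F :+ ((ps :+ tq) :+ d) :=
                      d :+ ((con 0ℚ :+ con 0ℚ) :+ (ps :+ (F :+ tq)))) refl
            (cost c F) (c p s) (c t q) _))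

    -- Simultaneous bounds for both colours of a tree

    -- m is the saving with respect to the bound 3 c(t). It is gained by letting the tour start
    -- at an arbitrary p rather than at the root.
    record Cover (t : Tree n) (p : Node n) (m : ℚ) : Set where
      field
        {own other} : ℚ
        anchor : Anchored (f (root t)) (In t) (root t) own
        tour   : Tour (not (f (root t))) (In t) p (root t) other
        bound  : (own + other) + m ≤ triple (treeCost t)

    -- Restates a cover for a colour `k` fixed from outside, whichever colour the root has. The
    -- anchored list always gives a closed tour, while the other tour starts at `p`; `X` lets one
    -- proof serve both closed and open tours.
    tours : ∀ {t p m} (X : Bool → ℚ → Set) →
            (∀ {k d} → Tour k (In t) (root t) (root t) d → X k d) →
            (∀ {k d} → Tour k (In t) p (root t) d → X k d) →
            Cover t p m → ∀ k →
            ∃₂ λ a b → X k a × X (not k) b × (a + b) + m ≤ triple (treeCost t)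
    tours {t} {m = m} X closed open′ cover k with k Bool.≟ f (root t)
    ... | yes refl = own , other , closed (Anchored⇒Tour anchor) , open′ tour , bound
      where open Cover cover
    ... | no k≢ with Bool.¬-not k≢
    ...   | refl = other , own , open′ tour
                 , subst (λ j → X j own) (sym (Bool.not-involutive (f (root t)))) (closed (Anchored⇒Tour anchor))
                 , subst (λ z → z + m ≤ triple (treeCost t)) (ℚ.+-comm own other) bound
      where open Cover cover

    closed-tours : ∀ {t m} → Cover t (root t) m → ∀ k →
                   ∃₂ λ a b → Tour k (In t) (root t) (root t) a × Tour (not k) (In t) (root t) (root t) b ×
                              (a + b) + m ≤ triple (treeCost t)
    closed-tours {t} = tours (λ k → Tour k (In t) (root t) (root t)) id id

    open-tours : ∀ {t p m} → Cover t p m → ∀ k →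
                 ∃₂ λ a b → (∃ λ q → Tour k (In t) q (root t) a) ×
                            (∃ λ q → Tour (not k) (In t) q (root t) b) ×
                            (a + b) + m ≤ triple (treeCost t)
    open-tours {t} = tours (λ k d → ∃ λ q → Tour k (In t) q (root t) d) (_ ,_) (_ ,_)

    Cover-leaf : ∀ v → Cover (leaf v) v 0ℚ
    Cover-leaf v = record
      { anchor = anchored [] (λ ()) refl (λ { refl _ → here }) ℚ.≤-refl
      ; tour   = skip (λ { refl → Bool.not-¬ refl }) (ℚ.≤-reflexive (zero-diagonal v))
      ; bound  = ℚ.≤-refl
      }

    -- The anchored colour uses the new edge once. The tour ends at the root of `t`, goes down to
    -- `s` and comes back, which makes three uses in all, so the saving stays `m`.
    Cover-graft : ∀ {t s p m} → Cover t p m → Cover s (root s) 0ℚ → Cover (graft t s) p m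
    Cover-graft {t} {s} {p} {m} cover cover′ with closed-tours cover′ (f (root t))
    ... | a , b , tour₁ , tour₂ , bound′ = record
      { anchor = Anchored-++ anchor tour₁
      ; tour   = Tour-move (Tour-++ (Tour-move tour) tour₂)
      ; bound  = transfer-≤ (ℚ.+-mono-≤ bound bound′) eq
      }
      where
      open Cover cover
      e = c (root t) (root s)
      eq : ((own + (e + a)) + (((other + e) + b) + c (root s) (root t)) + m)
             + (triple (treeCost t) + triple (treeCost s)) ≡
           triple (treeCost (graft t s)) + (((own + other) + m) + ((a + b) + 0ℚ))
      eq rewrite symmetric (root s) (root t) =
        solve 8 (λ own e a other b m t s →
            ((own :+ (e :+ a)) :+ (((other :+ e) :+ b) :+ e) :+ m)
              :+ ((t :+ (t :+ t)) :+ (s :+ (s :+ s))) :=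
            ((t :+ (e :+ s)) :+ ((t :+ (e :+ s)) :+ (t :+ (e :+ s))))
              :+ (((own :+ other) :+ m) :+ ((a :+ b) :+ con 0ℚ))) refl
          own e a other b m (treeCost t) (treeCost s)

    Cover-full : ∀ t → Cover t (root t) 0ℚ
    Cover-full (leaf v)    = Cover-leaf v
    Cover-full (graft t s) = Cover-graft (Cover-full t) (Cover-full s)

    -- The tour now starts inside `s`, climbs over the new edge once and finishes with the closed
    -- tour of `t`. With the one use by the anchored colour this makes two uses; the third adds to
    -- the saving.
    Cover-extend : ∀ {t s p m} → Cover t (root t) 0ℚ → Cover s p m →
                   ∃ λ q → Cover (graft t s) q (c (root t) (root s) + m)
    Cover-extend {t} {s} {p} {m} cover cover′ with open-tours cover′ (f (root t))
    ... | a , b , (_ , tour₁) , (_ , tour₂) , bound′ = _ , record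
      { anchor = Anchored-++ anchor (Tour-reverse tour₁)
      ; tour   = Tour-⊆ (λ i _ → swap i) (Tour-++ (Tour-move tour₂) tour)
      ; bound  = transfer-≤ (ℚ.+-mono-≤ bound bound′) eq
      }
      where
      open Cover cover
      e = c (root t) (root s)
      eq : ((own + (e + a)) + ((b + c (root s) (root t)) + other) + (e + m))
             + (triple (treeCost t) + triple (treeCost s)) ≡
           triple (treeCost (graft t s)) + (((own + other) + 0ℚ) + ((a + b) + m))
      eq rewrite symmetric (root s) (root t) =
        solve 8 (λ own e a other b m t s →
            ((own :+ (e :+ a)) :+ ((b :+ e) :+ other) :+ (e :+ m))
              :+ ((t :+ (t :+ t)) :+ (s :+ (s :+ s))) :=
            ((t :+ (e :+ s)) :+ ((t :+ (e :+ s)) :+ (t :+ (e :+ s))))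
              :+ (((own :+ other) :+ con 0ℚ) :+ ((a :+ b) :+ m))) refl
          own e a other b m (treeCost t) (treeCost s)

    Cover-weaken : ∀ {t p m m′} → m ≤ m′ → Cover t p m′ → Cover t p m
    Cover-weaken m≤m′ cover = record
      { anchor = anchor ; tour = tour
      ; bound  = ℚ.≤-trans (ℚ.+-monoʳ-≤ (own + other) m≤m′) bound }
      where open Cover cover

    -- On the way from the root down to `x` the value of `g` changes along some edge. Letting the
    -- tour start below that edge saves one use of it; subtrees off this way are grafted in full.
    Cover-crossing : ∀ (g : Node n → Bool) {M} t → AllEdges (λ x y → c x y ≤ M) t →
                     ∀ {x} → In t x → g x ≢ g (root t) →
                     ∃₂ λ a b → g a ≢ g b × c a b ≤ M × ∃ λ p → Cover t p (c a b)
    Cover-crossing g (leaf v) _ refl x≢ = contradiction refl x≢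
    Cover-crossing g (graft t s) (ts , _ , _) (inj₁ i) x≢ with Cover-crossing g t ts i x≢
    ... | a , b , a≢b , ab≤M , p , cover = a , b , a≢b , ab≤M , p , Cover-graft cover (Cover-full s)
    Cover-crossing g (graft t s) (_ , e≤M , ss) (inj₂ i) x≢ with g (root s) Bool.≟ g (root t)
    ... | no s≢t = root t , root s , s≢t ∘ sym , e≤M
                 , proj₁ extended , Cover-weaken (ℚ.≤-reflexive (sym (ℚ.+-identityʳ _))) (proj₂ extended)
      where extended = Cover-extend (Cover-full t) (Cover-full s)
    ... | yes s≡t with Cover-crossing g s ss i (λ x≡s → x≢ (trans x≡s s≡t))
    ...   | a , b , a≢b , ab≤M , p , cover = a , b , a≢b , ab≤M , proj₁ extended
      -- The saving on the edge between the two roots is given up: only the edge where `g` changes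
      -- is tracked.
      , Cover-weaken
          (transfer-≤ (nonneg (root t) (root s))
            (solve 2 (λ x y → x :+ y := (y :+ x) :+ con 0ℚ) refl (c a b) (c (root t) (root s))))
          (proj₂ extended)
      where extended = Cover-extend (Cover-full t) cover

    -- In a single colour the subtree's list becomes a closed tour with legs of length zero, so each
    -- edge of the tree is paid once.
    Anchored-tree : ∀ {k} t → (∀ {x} → In t x → f x ≡ k) → Anchored k (In t) (root t) (treeCost t)
    Anchored-tree (leaf v)    mono = anchored [] (λ ()) (mono refl) (λ { refl _ → here }) ℚ.≤-refl
    Anchored-tree (graft t s) mono =
      Anchored-++ (Anchored-tree t (mono ∘ inj₁)) (Anchored⇒Tour (Anchored-tree s (mono ∘ inj₂)))

    -- Upper bounds for the two returned trees

    module _ {k : Bool} {M M′ : List (Edge n)} {t s : Tree n}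
             (mst : IsMST c (λ x → f x ≡ k) M) (mst′ : IsMST c (λ x → f x ≡ not k) M′)
             (all : ∀ x → In t x ⊎ In s x) where

      -- For each colour the tour of `t` runs up to its root, crosses to the root of `s` and
      -- continues with the tour of `s` reversed. The edge between the roots is thus used twice, and
      -- both savings survive.
      MSTs-≤-covers : ∀ {p q m m′} → Cover t p m → Cover s q m′ →
        (cost c M + cost c M′) + (m + m′) ≤
        (triple (treeCost t) + triple (treeCost s)) + (c (root t) (root s) + c (root t) (root s))
      MSTs-≤-covers {m = m} {m′} cover cover′ with open-tours cover k | open-tours cover′ k
      ... | a , b , (_ , A) , (_ , B) , h | a′ , b′ , (_ , A′) , (_ , B′) , h′ =
        transfer-≤
          (ℚ.+-mono-≤ (ℚ.+-mono-≤ h h′)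
            (ℚ.+-mono-≤ (MST-≤-Tour mst  all (Tour-++ (Tour-move A) (Tour-reverse A′)))
                        (MST-≤-Tour mst′ all (Tour-++ (Tour-move B) (Tour-reverse B′)))))
          (solve 11 (λ M M′ m m′ t s e a b a′ b′ →
              ((M :+ M′) :+ (m :+ m′)) :+ ((t :+ s) :+ (((a :+ e) :+ a′) :+ ((b :+ e) :+ b′))) :=
              ((t :+ s) :+ (e :+ e)) :+ ((((a :+ b) :+ m) :+ ((a′ :+ b′) :+ m′)) :+ (M :+ M′))) refl
            (cost c M) (cost c M′) m m′ (triple (treeCost t)) (triple (treeCost s))
            (c (root t) (root s)) a b a′ b′)

      -- Colour `k` takes all of `t` and reaches its nodes in `s` over the edge between the roots;
      -- the other colour lives in `s` alone, so that edge is used only once.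
      MSTs-≤-mono-cover : ∀ {p m} → (∀ {x} → In t x → f x ≡ k) → Cover s p m →
        (cost c M + cost c M′) + m ≤ (treeCost t + c (root t) (root s)) + triple (treeCost s)
      MSTs-≤-mono-cover {m = m} mono cover with open-tours cover k
      ... | a , b , (_ , A) , (_ , B) , h =
        transfer-≤
          (ℚ.+-mono-≤ h
            (ℚ.+-mono-≤
              (MST-≤-Tour mst all (Anchored⇒Tour (Anchored-++ (Anchored-tree t mono) (Tour-reverse A))))
              (MST-≤-Tour mst′ all (Tour-⊆ only-s B))))
          (solve 8 (λ M M′ m t s e a b →
              ((M :+ M′) :+ m) :+ (s :+ ((t :+ (e :+ a)) :+ b)) :=
              ((t :+ e) :+ s) :+ (((a :+ b) :+ m) :+ (M :+ M′))) refl
            (cost c M) (cost c M′) m (treeCost t) (triple (treeCost s)) (c (root t) (root s)) a b)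
        where
        only-s : ∀ {x} → In t x ⊎ In s x → f x ≡ not k → In s x
        only-s (inj₁ i) fx = contradiction fx (Bool.not-¬ (mono i))
        only-s (inj₂ i) _  = i

      MSTs-≤-mono : (∀ {x} → In t x → f x ≡ k) → (∀ {x} → In s x → f x ≡ not k) →
        cost c M + cost c M′ ≤ treeCost t + treeCost s
      MSTs-≤-mono mono mono′ = ℚ.+-mono-≤
        (MST-≤-Tour mst all (Tour-⊆ only-t (Anchored⇒Tour (Anchored-tree t mono))))
        (MST-≤-Tour mst′ all (Tour-⊆ only-s (Anchored⇒Tour (Anchored-tree s mono′))))
        where
        only-t : ∀ {x} → In t x ⊎ In s x → f x ≡ k → In t x
        only-t (inj₁ i) _  = i
        only-t (inj₂ i) fx = contradiction (mono′ i) (Bool.not-¬ fx)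
        only-s : ∀ {x} → In t x ⊎ In s x → f x ≡ not k → In s x
        only-s (inj₁ i) fx = contradiction fx (Bool.not-¬ (mono i))
        only-s (inj₂ i) _  = i

  0≤treeCost : ∀ t → 0ℚ ≤ treeCost t
  0≤treeCost (leaf _)    = ℚ.≤-refl
  0≤treeCost (graft t s) =
    ℚ.+-mono-≤ (0≤treeCost t) (ℚ.+-mono-≤ (nonneg (root t) (root s)) (0≤treeCost s))

  -- Lower bound for a feasible solution

  module _ {col : Fin n → Bool} {R B T : List (Edge n)}
           (treeR : IsSpanningTree (ColorClass col red) R)
           (treeB : IsSpanningTree (ColorClass col blue) B)
           (mst : IsMST c AllNodes T) where

    -- An edge between the two colours joins the red and the blue tree into a spanning tree of all nodes.
    MST-≤-bicolored : ∀ {a b} → colorOf col a ≢ colorOf col b →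
                      cost c T ≤ c a b + (cost c R + cost c B)
    MST-≤-bicolored {a} {b} a≢b =
      subst (λ z → cost c T ≤ c a b + z) (cost-++ R B)
        (MST-≤ mst (λ _ → tt , tt) (λ u v _ _ → Conn-trans (Conn-sym (from-a u)) (from-a v)))
      where
      F = (a , b) ∷ R ++ B
      same-color : ∀ {u v} k → colorOf col u ≡ k → colorOf col v ≡ k → Conn F u v
      same-color true  cu cv = Conn-mono (there ∘ ∈-++⁺ˡ) (IsSpanningTree.connected treeR _ _ cu cv)
      same-color false cu cv = Conn-mono (there ∘ ∈-++⁺ʳ R) (IsSpanningTree.connected treeB _ _ cu cv)
      from-a : ∀ v → Conn F a v
      from-a v with colorOf col v Bool.≟ colorOf col a
      ... | yes v≡a = same-color (colorOf col a) refl v≡a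
      ... | no v≢a  = step (inj₁ (here refl))
        (same-color (colorOf col v) (trans (Bool.¬-not (a≢b ∘ sym)) (sym (Bool.¬-not v≢a))) refl)

-- Pairs lying inside one tree

HasPair : ∀ {n} → Tree n → Set
HasPair t = ∃ λ i → In t (i , false) × In t (i , true)

hasPair? : ∀ {n} (t : Tree n) → Dec (HasPair t)
hasPair? t = Fin.any? (λ i → in? t (i , false) ×-dec in? t (i , true))

¬HasPair⇒mate∉ : ∀ {n} {t : Tree n} → ¬ HasPair t → ∀ {i} b → In t (i , b) → ¬ In t (i , not b)
¬HasPair⇒mate∉ none false x∈t y∈t = none (_ , x∈t , y∈t)
¬HasPair⇒mate∉ none true  x∈t y∈t = none (_ , y∈t , x∈t)

colorOf-mate : ∀ {n} (col : Fin n → Bool) i b → colorOf col (i , not b) ≡ not (colorOf col (i , b))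
colorOf-mate col i false = sym (Bool.not-involutive (col i))
colorOf-mate col i true  = refl

-- The two nodes of a pair have opposite colours, so one of them differs from the root.
HasPair⇒bicolored : ∀ {n} (col : Fin n → Bool) (t : Tree n) → HasPair t →
                    ∃ λ x → In t x × colorOf col x ≢ colorOf col (root t)
HasPair⇒bicolored col t (i , p∈t , q∈t) with col i Bool.≟ colorOf col (root t)
... | no q≢   = (i , true) , q∈t , q≢
... | yes q≡ = (i , false) , p∈t , λ p≡ → Bool.not-¬ refl (trans q≡ (sym p≡))

-- The estimate for the two sides of the split

module Approximation {n : ℕ} {c : Node n → Node n → ℚ} (metric : IsMetric c)
  (zero-diagonal : ∀ v → c v v ≡ 0ℚ)
  {T : List (Edge n)} (mst : IsMST c AllNodes T)
  {col : Fin n → Bool} {Tb Tr : List (Edge n)}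
  (mstB : IsMST c (ColorClass col blue) Tb) (mstR : IsMST c (ColorClass col red) Tr)
  {col′ : Fin n → Bool} {R B : List (Edge n)}
  (treeR : IsSpanningTree (ColorClass col′ red) R)
  (treeB : IsSpanningTree (ColorClass col′ blue) B)
  where

  open IsMetric metric
  open Metric metric
  open Coloring zero-diagonal (colorOf col)

  0≤OPT : 0ℚ ≤ cost c R + cost c B
  0≤OPT = ℚ.+-mono-≤ (0≤cost R) (0≤cost B)

  approximation-trees : ∀ t s →
    treeCost t + (c (root t) (root s) + treeCost s) ≤ cost c T →
    AllEdges (λ x y → c x y ≤ c (root t) (root s)) t →
    AllEdges (λ x y → c x y ≤ c (root t) (root s)) s →
    (∀ x → In t x ⊎ In s x) →
    (∀ i b → In t (i , b) → In s (i , not b) → colorOf col (i , b) ≡ blue) →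
    cost c Tb + cost c Tr ≤ triple (cost c R + cost c B)
  approximation-trees t s total t≤e s≤e all split = cases (hasPair? t) (hasPair? s)
    where
    e = c (root t) (root s)
    S = cost c Tb + cost c Tr
    O = cost c R + cost c B
    L = treeCost t
    K = treeCost s
    C = cost c T

    -- The mate of every node of `t` lies in `s`, so the split rule applies to every node of `t`.
    all-blue : ¬ HasPair t → ∀ {x} → In t x → colorOf col x ≡ blue
    all-blue none {i , b} x∈t with all (i , not b)
    ... | inj₁ y∈t = contradiction y∈t (¬HasPair⇒mate∉ {t = t} none b x∈t)
    ... | inj₂ y∈s = split i b x∈t y∈s

    all-red : ¬ HasPair s → ∀ {x} → In s x → colorOf col x ≡ red
    all-red none {i , b} x∈s with all (i , not b)
    ... | inj₂ y∈s = contradiction y∈s (¬HasPair⇒mate∉ {t = s} none b x∈s)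
    ... | inj₁ y∈t = Bool.not-injective (trans (sym (colorOf-mate col i b))
      (split i (not b) y∈t (subst (λ b′ → In s (i , b′)) (sym (Bool.not-involutive b)) x∈s)))

    OPT-≥ : ∀ {a b} → colorOf col′ a ≢ colorOf col′ b → C ≤ c a b + O
    OPT-≥ = MST-≤-bicolored treeR treeB mst

    -- One edge does double duty: being bicoloured in `col′` it bounds the feasible solution from
    -- below, and lying on a path from the root it is saved in the cover for `col`.
    crossing : ∀ t → AllEdges (λ x y → c x y ≤ e) t → HasPair t →
               ∃ λ m → C ≤ m + O × m ≤ e × ∃ λ p → Cover t p m
    crossing t t≤e pair with HasPair⇒bicolored col′ t pair
    ... | x , x∈t , x≢ with Cover-crossing (colorOf col′) t t≤e x∈t x≢
    ...   | a , b , a≢b , ab≤e , cover = c a b , OPT-≥ a≢b , ab≤e , cover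

    -- Here `a` is the cost of the monochromatic side. Since `a + e + 3b` is at most `3C - 2a - 2e`
    -- and `C ≤ m + O`, the excess of `S` over `3O` is at most `2(m - e) - 2a`, which is not
    -- positive.
    one-sided : ∀ {m a b} → C ≤ m + O → m ≤ e → 0ℚ ≤ a → a + (e + b) ≤ C →
                S + m ≤ (a + e) + triple b → S ≤ triple O
    one-sided {m} {a} {b} C≤ m≤e 0≤a ≤C S≤ = transfer-≤
      (ℚ.+-mono-≤ S≤ (ℚ.+-mono-≤ (triple-mono C≤)
        (ℚ.+-mono-≤ (ℚ.+-mono-≤ m≤e m≤e) (ℚ.+-mono-≤ (ℚ.+-mono-≤ 0≤a 0≤a) (triple-mono ≤C)))))
      (solve 7 (λ S O C m e a b →
          let ae = a :+ (e :+ b) ; mo = m :+ O in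
          S :+ (((a :+ e) :+ (b :+ (b :+ b))) :+ ((mo :+ (mo :+ mo)) :+
            ((e :+ e) :+ ((a :+ a) :+ (C :+ (C :+ C)))))) :=
          (O :+ (O :+ O)) :+ ((S :+ m) :+ ((C :+ (C :+ C)) :+
            ((m :+ m) :+ ((con 0ℚ :+ con 0ℚ) :+ (ae :+ (ae :+ ae))))))) refl
        S O C m e a b)

    cases : Dec (HasPair t) → Dec (HasPair s) → S ≤ triple O
    cases (yes pair) (yes pair′) with crossing t t≤e pair | crossing s s≤e pair′
    ... | m , C≤ , m≤e , _ , cover | m′ , C≤′ , m′≤e , _ , cover′ = transfer-≤
      (ℚ.+-mono-≤ (MSTs-≤-covers mstB mstR all cover cover′)
        (ℚ.+-mono-≤ (triple-mono total)
          (ℚ.+-mono-≤ C≤ (ℚ.+-mono-≤ C≤ (ℚ.+-mono-≤ C≤′ m≤e)))))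
      (solve 8 (λ S O C m m′ e L K →
          let W = L :+ (e :+ K) in
          S :+ ((((L :+ (L :+ L)) :+ (K :+ (K :+ K))) :+ (e :+ e)) :+ ((C :+ (C :+ C)) :+
            ((m :+ O) :+ ((m :+ O) :+ ((m′ :+ O) :+ e))))) :=
          (O :+ (O :+ O)) :+ ((S :+ (m :+ m′)) :+ ((W :+ (W :+ W)) :+
            (C :+ (C :+ (C :+ m)))))) refl
        S O C m m′ e L K)
    cases (no none) (yes pair) with crossing s s≤e pair
    ... | m , C≤ , m≤e , _ , cover = one-sided C≤ m≤e (0≤treeCost t) total
      (MSTs-≤-mono-cover mstB mstR all (all-blue none) cover)
    cases (yes pair) (no none) with crossing t t≤e pair
    ... | m , C≤ , m≤e , _ , cover = one-sided C≤ m≤e (0≤treeCost s)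
      (subst (_≤ C) (solve 3 (λ L e K → L :+ (e :+ K) := K :+ (e :+ L)) refl L e K) total)
      (subst₂ (λ x y → x + m ≤ (K + y) + triple L)
        (ℚ.+-comm (cost c Tr) (cost c Tb)) (symmetric (root s) (root t))
        (MSTs-≤-mono-cover mstR mstB (swap ∘ all) (all-red none) cover))
    cases (no none) (no none′)
      -- The joined tree contains all nodes, hence the pair of its root. Only the bicoloured edge is
      -- taken from `crossing`: `S ≤ C - e ≤ O + m - e ≤ O`.
      with crossing (graft t s) (t≤e , ℚ.≤-refl , s≤e) (proj₁ (root t) , all _ , all _)
    ... | m , C≤ , m≤e , _ = transfer-≤
      (ℚ.+-mono-≤ (MSTs-≤-mono mstB mstR all (all-blue none) (all-red none′))
        (ℚ.+-mono-≤ total (ℚ.+-mono-≤ C≤ (ℚ.+-mono-≤ m≤e (ℚ.+-mono-≤ 0≤OPT 0≤OPT)))))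
      (solve 7 (λ S O C m e L K →
          S :+ ((L :+ K) :+ (C :+ ((m :+ O) :+ (e :+ (O :+ O))))) :=
          (O :+ (O :+ O)) :+ (S :+ ((L :+ (e :+ K)) :+ (C :+ (m :+ (con 0ℚ :+ con 0ℚ)))))) refl
        S O C m e L K)

  -- Splitting the minimum spanning tree at the deleted edge

  approximation : ∀ {ex} (p : ex ∈ T) → (∀ {e} → e ∈ T → weight c e ≤ weight c ex) →
                  SplitColoring T p col →
                  cost c Tb + cost c Tr ≤ triple (cost c R + cost c B)
  approximation {u , v} p heaviest split =
    approximation-trees L.tree K.tree total
      (edges-≤ L.tree L.edges) (edges-≤ K.tree K.edges) all
      (λ i b x∈L y∈K → split i b (conn L.tree L.same-root L.edges x∈L) (conn K.tree K.same-root K.edges y∈K))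
    where
    F = T ─ p
    growL : Growth F F (leaf u)
    growL = grow (length F) F refl id (leaf u) tt
    module L = Growth growL
    -- The second tree draws only on edges left over by the first, so no edge is charged twice in
    -- `total`.
    growK : Growth F L.rest (leaf v)
    growK = grow (length L.rest) L.rest refl L.rest⊆ (leaf v) tt
    module K = Growth growK

    conn : ∀ {r x} t → root t ≡ r → AllEdges (Joins F) t → In t x → Conn F r x
    conn t refl = In⇒Conn t

    edges-≤ : ∀ t → AllEdges (Joins F) t → AllEdges (λ x y → c x y ≤ c (root L.tree) (root K.tree)) t
    edges-≤ t rewrite L.same-root | K.same-root = AllEdges-map
      (λ { {x} {y} (inj₁ i) → heaviest (∈-─⁻ p i)
         ; {x} {y} (inj₂ i) → subst (_≤ c u v) (symmetric y x) (heaviest (∈-─⁻ p i)) }) t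

    lookup-p : ∀ {e T} (p : e ∈ T) → Any.lookup p ≡ e
    lookup-p p = sym (lookup-result p)

    total : treeCost L.tree + (c (root L.tree) (root K.tree) + treeCost K.tree) ≤ cost c T
    total rewrite L.same-root | K.same-root | cost-─ p | lookup-p p = transfer-≤
      (ℚ.+-mono-≤ L.total (ℚ.+-mono-≤ K.total (0≤cost K.rest)))
      (solve 6 (λ l e k rl rk F →
          (l :+ (e :+ k)) :+ ((con 0ℚ :+ F) :+ ((con 0ℚ :+ rl) :+ rk)) :=
          (e :+ F) :+ ((l :+ rl) :+ ((k :+ rk) :+ con 0ℚ))) refl
        (treeCost L.tree) (c u v) (treeCost K.tree) (cost c L.rest) (cost c K.rest) (cost c F))

    Covered : Node n → Set
    Covered x = In L.tree x ⊎ In K.tree x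

    -- The deleted edge has one end in each tree. Any other edge is used by one of the trees, which
    -- then contains both ends, or is left over by both and touches neither. So coverage spreads
    -- along `T`.
    ends : ∀ {x y} → (x , y) ≡ Any.lookup p ⊎ (x , y) ∈ F →
           (Covered x → Covered y) × (Covered y → Covered x)
    ends (inj₁ eq) with trans eq (lookup-p p)
    ... | refl = (λ _ → inj₂ (K.extends refl)) , (λ _ → inj₁ (L.extends refl))
    ends (inj₂ i) with L.used i
    ... | inj₂ (x∈L , y∈L) = (λ _ → inj₁ y∈L) , (λ _ → inj₁ x∈L)
    ... | inj₁ i∈rest with K.used i∈rest
    ...   | inj₂ (x∈K , y∈K) = (λ _ → inj₂ y∈K) , (λ _ → inj₂ x∈K)
    ...   | inj₁ i∈rest′ =
      [ (λ x∈L → contradiction (inj₁ x∈L) (L.untouched i∈rest))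
      , (λ x∈K → contradiction (inj₁ x∈K) (K.untouched i∈rest′)) ]′ ,
      [ (λ y∈L → contradiction (inj₂ y∈L) (L.untouched i∈rest))
      , (λ y∈K → contradiction (inj₂ y∈K) (K.untouched i∈rest′)) ]′

    closed : ∀ {x y} → Joins T x y → Covered x → Covered y
    closed (inj₁ i) = proj₁ (ends (∈-─⁺ p i))
    closed (inj₂ i) = proj₂ (ends (∈-─⁺ p i))

    all : ∀ x → Covered x
    all x = Conn-closed Covered closed (IsSpanningTree.connected (IsMST.tree mst) u x tt tt)
      (inj₁ (L.extends refl))

-- Reduction to a zero diagonal

-- A metric in the sense of IsMetric may be positive on the diagonal. Trees contain no loops, so
-- zeroing the diagonal changes neither the metric axioms nor any cost that matters.
module ZeroDiagonal {n : ℕ} {c : Node n → Node n → ℚ} (metric : IsMetric c) where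

  open IsMetric metric

  c₀ : Node n → Node n → ℚ
  c₀ u v with u ≟ₙ v
  ... | yes _ = 0ℚ
  ... | no _  = c u v

  c₀-diagonal : ∀ v → c₀ v v ≡ 0ℚ
  c₀-diagonal v with v ≟ₙ v
  ... | yes _  = refl
  ... | no v≢v = contradiction refl v≢v

  c₀-off-diagonal : ∀ {u v} → u ≢ v → c₀ u v ≡ c u v
  c₀-off-diagonal {u} {v} u≢v with u ≟ₙ v
  ... | yes u≡v = contradiction u≡v u≢v
  ... | no _    = refl

  c₀-nonneg : ∀ u v → 0ℚ ≤ c₀ u v
  c₀-nonneg u v with u ≟ₙ v
  ... | yes _ = ℚ.≤-refl
  ... | no _  = nonneg u v

  c₀-symmetric : ∀ u v → c₀ u v ≡ c₀ v u
  c₀-symmetric u v with u ≟ₙ v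
  ... | yes refl = sym (c₀-diagonal u)
  ... | no u≢v   = trans (symmetric u v) (sym (c₀-off-diagonal (u≢v ∘ sym)))

  c₀-triangle : ∀ u v w → c₀ u w ≤ c₀ u v + c₀ v w
  c₀-triangle u v w with u ≟ₙ w
  ... | yes _ = ℚ.+-mono-≤ (c₀-nonneg u v) (c₀-nonneg v w)
  ... | no u≢w with u ≟ₙ v
  ...   | yes refl = ℚ.≤-reflexive (sym (trans (ℚ.+-identityˡ (c₀ u w)) (c₀-off-diagonal u≢w)))
  ...   | no _ with v ≟ₙ w
  ...     | yes refl = ℚ.≤-reflexive (sym (ℚ.+-identityʳ (c u w)))
  ...     | no _     = triangle u v w

  metric₀ : IsMetric c₀
  metric₀ = record { nonneg = c₀-nonneg ; symmetric = c₀-symmetric ; triangle = c₀-triangle }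

  module _ {S : Node n → Set} {F : List (Edge n)} (tree : IsSpanningTree S F) where

    -- The ends of a loop stay joined by the empty path when the loop is removed, against
    -- acyclicity.
    loopless : ∀ {u v} → (u , v) ∈ F → u ≢ v
    loopless i refl = IsSpanningTree.acyclic tree i here

    weight₀ : ∀ {e} → e ∈ F → weight c₀ e ≡ weight c e
    weight₀ i = c₀-off-diagonal (loopless i)

    cost₀ : cost c₀ F ≡ cost c F
    cost₀ = go F weight₀
      where
      go : ∀ G → (∀ {e} → e ∈ G → weight c₀ e ≡ weight c e) → cost c₀ G ≡ cost c G
      go []      _  = refl
      go (e ∷ G) eq = cong₂ _+_ (eq (here refl)) (go G (eq ∘ there))

  IsMST₀ : ∀ {S F} → IsMST c S F → IsMST c₀ S F
  IsMST₀ mst = record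
    { tree    = tree
    ; minimal = λ F′ tree′ → subst₂ _≤_ (sym (cost₀ tree)) (sym (cost₀ tree′)) (minimal F′ tree′)
    }
    where open IsMST mst

theorem2 : (n : ℕ) → 2 ∣ n →
    (c : Node n → Node n → ℚ) → IsMetric c →
    (T : List (Edge n)) → IsMST c AllNodes T →
    (ex : Edge n) (p : ex ∈ T) → (∀ {e} → e ∈ T → weight c e ≤ weight c ex) →
    (col : Fin n → Bool) → SplitColoring T p col →
    (Tb Tr : List (Edge n)) →
    IsMST c (ColorClass col blue) Tb → IsMST c (ColorClass col red) Tr →
    (col' : Fin n → Bool) (R B : List (Edge n)) →
    IsSpanningTree (ColorClass col' red) R → IsSpanningTree (ColorClass col' blue) B →
    cost c Tb + cost c Tr ≤ three * (cost c R + cost c B)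
theorem2 n _ c metric T mst ex p heaviest col split Tb Tr mstB mstR col' R B treeR treeB =
  -- The bound holds for `c₀` and is read back for `c`, as all four edge lists are spanning trees.
  subst₂ _≤_
    (cong₂ _+_ (cost₀ (IsMST.tree mstB)) (cost₀ (IsMST.tree mstR)))
    (trans (cong triple (cong₂ _+_ (cost₀ treeR) (cost₀ treeB))) (sym (three*≡triple (cost c R + cost c B))))
    (approximation p
      (λ i → subst₂ _≤_ (sym (weight₀ tree i)) (sym (weight₀ tree p)) (heaviest i)) split)
  where
  open ZeroDiagonal metric
  open IsMST mst using (tree)
  open Approximation metric₀ c₀-diagonal (IsMST₀ mst) {col} (IsMST₀ mstB) (IsMST₀ mstR) {col'} treeR treeB
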